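{- Let $m \geq 0$, $n \geq 1$ be integers and let $c = (c^t; c^b)$ be a sorted deterministically recurrent configuration on $K_{m,n}^0$. Let $k_j := |\{ i \in \{1,\ldots,m\} : c^t_i < j\}|$ for $j \in \{1,\ldots,n\}$, and let $(F_1, F_2) := (F(k), F(c^b))$. Then $\mathrm{Diff}(F_1, F_2) = \Phi(c)$; that is, $\Phi = \mathrm{Diff} \circ \Psi$ on sorted deterministically recurrent configurations, where $\Psi(c) := (F(k), F(c^b))$.
   Context: $K_{m,n}^0$ is the complete bipartite graph with "top" vertices $v^t_0, \ldots, v^t_m$ and "bottom" vertices $v^b_1, \ldots, v^b_n$, with an edge between every top and every bottom vertex; $v^t_0$ is the sink. A configuration is a vector $c = (c^t_1, \ldots, c^t_m; c^b_1, \ldots, c^b_n)$ of non-negative integers; it is sorted if $c^t$, $c^b$ are weakly increasing, stable if $c^t_i < n$ and $c^b_j < m+1$ for all $i,j$. Abelian sandpile model (ASM): an unstable non-sink vertex topples by sending one grain to each neighbour (bottom vertices also to the sink); grains sent to the sink disappear. In the Markov chain on stable configurations which adds a grain to a uniformly random non-sink vertex and stabilises by the ASM, a stable configuration is deterministically recurrent if it is a recurrent state. Ferrers diagrams: for a weakly increasing sequence $s=(s_1,\ldots,s_r)$ of non-negative integers, $F(s)$ is the left-aligned diagram with $s_i$ unit cells in row $i$, rows numbered from bottom to top; we place it with its bottom-left corner at the origin, so row $i$ occupies cells $[x-1,x]\times[i-1,i]$ for $1 \le x \le s_i$. For $F_1 = F(s)$ and $F_2 = F(s')$ with $s, s'$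 of length $n$ and $s_n = s'_n = m$: let $F_1' := F(0, s_1, \ldots, s_{n-1}, s_n + 1)$ (add an empty row at the bottom and one cell to the top row) and $F_2' := F(s'_1 + 1, \ldots, s'_n + 1, m+1)$ (add one cell to each row and a full row of $m+1$ cells at the top). $\mathrm{Diff}(F_1,F_2) := F_2' \setminus F_1'$ is the set of unit cells of $F_2'$ not in $F_1'$. A parallelogram polyomino in the box $[0,m+1]\times[0,n]$ is the set of unit cells lying between two lattice paths $\mathcal{U}$ (upper) and $\mathcal{L}$ (lower) from $(0,0)$ to $(m+1,n)$ with steps $N=(0,1)$, $E=(1,0)$, which meet only at their endpoints. The Dukes–Le Borgne map $\Phi$: for a sorted stable $c$, $\mathcal{U}(c^t)$ is the path from $(0,0)$ to $(m+1,n)$ whose $E$ steps occur at heights $1+c^t_1, \ldots, 1+c^t_m, n$ (in this order), and $\mathcal{L}(c^b)$ is the path from $(0,0)$ to $(m+1,n)$ whose $N$ steps occur at $x$-coordinates $1+c^b_1, \ldots, 1+c^b_n$; $\Phi(c)$ is the set of unit cells between $\mathcal{U}(c^t)$ and $\mathcal{L}(c^b)$. It is known that $\Phi$ is a bijection from sorted deterministically recurrent configurations on $K_{m,n}^0$ to parallelogram polyominoes with bounding box $[0,m+1]\times[0,n]$. -}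

module Defs where

open import Data.Bool.Base using (if_then_else_)
open import Data.Fin.Base as Fin using (Fin; zero; suc; toℕ)
open import Data.Fin.Properties using (any?)
open import Data.Integer.Base using (1ℤ)
open import Data.List.Base as List using (List; []; _∷_; _++_)
open import Data.List.Membership.Propositional using (_∈_)
open import Data.Nat.Base as ℕ
  using (ℕ; zero; suc; _+_; _*_; _∸_; _≤_; _<_)
open import Data.Nat.Induction using (Acc; acc; <-wellFounded)
import Data.Nat.Properties as ℕₚ
open import Data.Nat.Tactic.RingSolver using (solve-∀)
open import Data.Product.Base using (Σ-syntax; ∃; ∃-syntax; _×_; _,_; proj₁; proj₂)
open import Data.Rational.Base as ℚ using (ℚ; 0ℚ; 1ℚ)
open import Data.Sum.Base using (_⊎_; inj₁; inj₂)
open import Data.Vec.Base as Vec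
  using (Vec; []; _∷_; _∷ʳ_; lookup; tabulate; updateAt; sum; count; init; last; toList)
open import Data.Vec.Properties using (≡-dec)
open import Level using (0ℓ)
open import Relation.Binary.Construct.Closure.ReflexiveTransitive using (Star; ε; _◅_)
open import Relation.Binary.Core using (_Preserves_⟶_)
open import Relation.Binary.Definitions using (DecidableEquality)
open import Relation.Binary.PropositionalEquality
  using (_≡_; refl; sym; trans; cong; cong₂)
open import Relation.Nullary using (Dec; yes; no; does)
open import Relation.Nullary.Decidable using (map′; _×-dec_)
open import Relation.Unary using (Pred; _∩_; _∖_)

private
  variable
    m n r : ℕ

Increasing : Vec ℕ r → Set
Increasing s = lookup s Preserves Fin._≤_ ⟶ _≤_

-- The sandpile model on the complete bipartite graph with top vertices
-- 0, …, m (vertex 0 being the sink) and bottom vertices 1, …, n.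

-- The non-sink vertices: inj₁ for top, inj₂ for bottom.
Vertex : ℕ → ℕ → Set
Vertex m n = Fin m ⊎ Fin n

degree : Vertex m n → ℕ
degree {m} {n} (inj₁ _) = n
degree {m} {n} (inj₂ _) = suc m

record Config (m n : ℕ) : Set where
  constructor _⨾_
  field
    top : Vec ℕ m
    bot : Vec ℕ n

open Config public

grains : Config m n → Vertex m n → ℕ
grains c (inj₁ i) = lookup (top c) i
grains c (inj₂ j) = lookup (bot c) j

Sorted : Config m n → Set
Sorted c = Increasing (top c) × Increasing (bot c)

Stable : Config m n → Set
Stable c = ∀ v → grains c v < degree v

Unstable : Config m n → Vertex m n → Set
Unstable c v = degree v ≤ grains c v

addGrain : Vertex m n → Config m n → Config m n
addGrain (inj₁ i) (t ⨾ b) = updateAt t i suc ⨾ b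
addGrain (inj₂ j) (t ⨾ b) = t ⨾ updateAt b j suc

-- One of the m + 1 grains leaving a bottom vertex goes to the sink and is lost.
topple : Vertex m n → Config m n → Config m n
topple {m} {n} (inj₁ i) (t ⨾ b) = updateAt t i (_∸ n) ⨾ Vec.map suc b
topple {m} {n} (inj₂ j) (t ⨾ b) = Vec.map suc t ⨾ updateAt b j (_∸ suc m)

infix 4 _⟶_ _⟶*_

_⟶_ : Config m n → Config m n → Set
c ⟶ d = ∃[ v ] Unstable c v × d ≡ topple v c

_⟶*_ : Config m n → Config m n → Set
_⟶*_ = Star _⟶_

-- Toppling terminates because this weighted number of grains decreases.
potential : Config m n → ℕ
potential {m} (t ⨾ b) = (2 + m) * sum t + (1 + m) * sum b

sum-suc : (xs : Vec ℕ r) → sum (Vec.map suc xs) ≡ r + sum xs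
sum-suc []       = refl
sum-suc {suc r} (x ∷ xs) =
  trans (cong (suc x +_) (sum-suc xs)) (lemma x r (sum xs))
  where
  lemma : ∀ x r s → suc x + (r + s) ≡ suc r + (x + s)
  lemma = solve-∀

sum-∸ : ∀ k (xs : Vec ℕ r) i → k ≤ lookup xs i →
        sum xs ≡ k + sum (updateAt xs i (_∸ k))
sum-∸ k (x ∷ xs) zero k≤x =
  trans (cong (_+ sum xs) (sym (ℕₚ.m+[n∸m]≡n k≤x))) (ℕₚ.+-assoc k (x ∸ k) (sum xs))
sum-∸ k (x ∷ xs) (suc i) k≤ =
  trans (cong (_+_ x) (sum-∸ k xs i k≤)) (lemma x k (sum (updateAt xs i (_∸ k))))
  where
  lemma : ∀ x k s → x + (k + s) ≡ k + (x + s)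
  lemma = solve-∀

topple-potential : (c : Config m (suc n)) (v : Vertex m (suc n)) → Unstable c v →
                   potential (topple v c) < potential c
topple-potential {m} {n} (t ⨾ b) (inj₁ i) u
  rewrite sum-suc b | sum-∸ (suc n) t i u =
  ℕₚ.≤-trans (ℕₚ.m≤m+n _ n) (ℕₚ.≤-reflexive (lemma m n (sum (updateAt t i (_∸ suc n))) (sum b)))
  where
  lemma : ∀ m n T B → suc ((2 + m) * T + (1 + m) * (suc n + B)) + n
                    ≡ (2 + m) * (suc n + T) + (1 + m) * B
  lemma = solve-∀
topple-potential {m} {n} (t ⨾ b) (inj₂ j) u
  rewrite sum-suc t | sum-∸ (suc m) b j u =
  ℕₚ.≤-reflexive (lemma m (sum t) (sum (updateAt b j (_∸ suc m))))
  where
  lemma : ∀ m T B → suc ((2 + m) * (m + T) + (1 + m) * B)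
                  ≡ (2 + m) * T + (1 + m) * (suc m + B)
  lemma = solve-∀

unstable? : (c : Config m n) → Dec (∃ (Unstable c))
unstable? {m} {n} c with any? (λ i → n ℕₚ.≤? lookup (top c) i)
... | yes (i , u) = yes (inj₁ i , u)
... | no ¬t with any? (λ j → suc m ℕₚ.≤? lookup (bot c) j)
...   | yes (j , u) = yes (inj₂ j , u)
...   | no ¬b = no λ { (inj₁ i , u) → ¬t (i , u) ; (inj₂ j , u) → ¬b (j , u) }

stabilise′ : (c : Config m (suc n)) → Acc _<_ (potential c) →
             Σ[ d ∈ Config m (suc n) ] (c ⟶* d) × Stable d
stabilise′ c (acc rs) with unstable? c
... | no ¬u = c , ε , λ v → ℕₚ.≰⇒> (λ u → ¬u (v , u))
... | yes (v , u) with stabilise′ (topple v c) (rs (topple-potential c v u))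
...   | d , steps , stable = d , (v , u , refl) ◅ steps , stable

-- The order in which unstable vertices topple (tops first, then by index) is
-- immaterial, the model being abelian.
stabilise : (c : Config m (suc n)) → Σ[ d ∈ Config m (suc n) ] (c ⟶* d) × Stable d
stabilise c = stabilise′ c (<-wellFounded (potential c))

next : Vertex m (suc n) → Config m (suc n) → Config m (suc n)
next v c = proj₁ (stabilise (addGrain v c))

_≟_ : DecidableEquality (Config m n)
(t ⨾ b) ≟ (t′ ⨾ b′) =
  map′ (λ (p , q) → cong₂ _⨾_ p q) (λ { refl → refl , refl })
       (≡-dec ℕₚ._≟_ t t′ ×-dec ≡-dec ℕₚ._≟_ b b′)

vertices : ∀ m n → List (Vertex m n)
vertices m n = List.map inj₁ (List.allFin m) ++ List.map inj₂ (List.allFin n)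

-- Expectation over a uniformly random non-sink vertex.
average : (Vertex m (suc n) → ℚ) → ℚ
average {m} {n} f =
  List.foldr ℚ._+_ 0ℚ (List.map f (vertices m (suc n))) ℚ.* (1ℤ ℚ./ (suc n + m))

-- hitProb k d c is the probability that the chain started at c visits d at one
-- of the times 1, …, k.
hitProb : ℕ → Config m (suc n) → Config m (suc n) → ℚ
hitProb zero    d c = 0ℚ
hitProb (suc k) d c =
  average λ v → if does (next v c ≟ d) then 1ℚ else hitProb k d (next v c)

-- The probability of ever returning is the supremum over k of the probability
-- of returning by time k; a state is recurrent when this supremum is 1.
RecurrentState : Config m (suc n) → Set
RecurrentState c = ∀ δ → 0ℚ ℚ.< δ → ∃[ k ] 1ℚ ℚ.- δ ℚ.< hitProb k c c

DeterministicallyRecurrent : Config m (suc n) → Set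
DeterministicallyRecurrent c = Stable c × RecurrentState c

-- The cell (x , y) is the unit square [x, x+1] × [y, y+1].
Cell : Set
Cell = ℕ × ℕ

F : Vec ℕ r → Pred Cell 0ℓ
F s (x , y) = ∃[ i ] toℕ i ≡ y × x < lookup s i

-- Ferrers diagrams may have empty rows, so the pair of diagrams (F(s) , F(s′)) is
-- represented by the pair of row-length sequences (s , s′).
record DiffDomain (m : ℕ) (p : Vec ℕ (suc n) × Vec ℕ (suc n)) : Set where
  field
    increasing₁ : Increasing (proj₁ p)
    increasing₂ : Increasing (proj₂ p)
    last₁       : last (proj₁ p) ≡ m
    last₂       : last (proj₂ p) ≡ m

Diff : (p : Vec ℕ (suc n) × Vec ℕ (suc n)) → DiffDomain m p → Pred Cell 0ℓ
Diff {m = m} (s , s′) _ =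
  F (Vec.map suc s′ ∷ʳ suc m) ∖ F (0 ∷ (init s ∷ʳ suc (last s)))

-- The entry of index j : Fin n is k_{j+1} = |{ i : cᵗᵢ < j + 1 }|.
kVec : Config m n → Vec ℕ n
kVec c = tabulate λ j → count (ℕₚ._<? suc (toℕ j)) (top c)

Ψ : Config m n → Vec ℕ n × Vec ℕ n
Ψ c = kVec c , bot c

data Step : Set where
  N E : Step

Path : Set
Path = List Step

-- Given a weakly increasing list of levels, the path whose b-steps occur after
-- exactly that many a-steps, and which has `end` a-steps in total. The argument
-- `cur` is the number of a-steps already made.
pathWith : (a b : Step) (cur end : ℕ) → List ℕ → Path
pathWith a b cur end []       = List.replicate (end ∸ cur) a
pathWith a b cur end (l ∷ ls) = List.replicate (l ∸ cur) a ++ b ∷ pathWith a b l end ls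

𝒰 : ∀ n → Vec ℕ m → Path
𝒰 n ct = pathWith N E 0 n (toList (Vec.map suc ct ∷ʳ n))

𝓛 : ∀ m → Vec ℕ n → Path
𝓛 m cb = pathWith E N 0 (suc m) (toList (Vec.map suc cb))

-- The starting points of the E-steps of a path starting at the given point.
eastSteps : ℕ × ℕ → Path → List (ℕ × ℕ)
eastSteps _       []      = []
eastSteps (x , y) (N ∷ p) = eastSteps (x , suc y) p
eastSteps (x , y) (E ∷ p) = (x , y) ∷ eastSteps (suc x , y) p

-- A cell lies below (above) a path from the origin if the E-step in its column
-- passes along or above its top side (along or below its bottom side).
Below Above : Path → Pred Cell 0ℓ
Below p (x , y) = ∃[ h ] (x , h) ∈ eastSteps (0 , 0) p × suc y ≤ h
Above p (x , y) = ∃[ h ] (x , h) ∈ eastSteps (0 , 0) p × h ≤ y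

Φ : Config m n → Pred Cell 0ℓ
Φ {m} {n} c = Below (𝒰 n (top c)) ∩ Above (𝓛 m (bot c))

{-# OPTIONS --safe #-}

-- Row y < n of Diff (rows and bottom entries counted from 0) consists of the cells x
-- with #{ i : cᵗᵢ < y } ≤ x ≤ cᵇ_y, and for sorted c these are the two conditions of
-- lying below 𝒰 and above 𝓛. The hypothesis
-- of recurrence is needed for max cᵇ = m: from any stable configuration the chain
-- fills up, with positive probability, to the maximal stable configuration, from
-- where it only visits configurations without forbidden subconfigurations. Hence a
-- recurrent c has none, and applied to the set of all vertices this yields a bottom
-- vertex with at least m grains.

module Submission where

open import Defs
open import Data.Bool.Base using (if_then_else_)
open import Data.Fin.Base using (Fin; zero; suc; toℕ; fromℕ; fromℕ<; inject₁)
import Data.Fin.Properties as Finₚ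
open import Data.Fin.Relation.Unary.Top using (view; ‵fromℕ; ‵inject₁)
open import Data.Fin.Subset using (Subset; Nonempty; ∣_∣; ⊤; inside; outside)
  renaming (_∈_ to _∈ˢ_)
open import Data.Fin.Subset.Properties
  using (_∈?_; nonempty?; Empty-unique; ∣⊥∣≡0; ∣⊤∣≡n; ∣p∣≤n; ∈⊤)
open import Data.Integer.Base as ℤ using (1ℤ)
import Data.Integer.Properties as ℤₚ
open import Data.List.Base as List using (List; []; _∷_; _++_)
open import Data.List.Membership.Propositional using (_∈_)
open import Data.List.Membership.Propositional.Properties
  using (∈-allFin; ∈-map⁺; ∈-++⁺ˡ; ∈-++⁺ʳ)
open import Data.List.Properties using (++-identityʳ; length-++; length-map; length-tabulate)
open import Data.List.Relation.Unary.Any using (here; there)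
open import Data.Nat.Base using (ℕ; zero; suc; _+_; _∸_; _≤_; _<_; s≤s; z≤n)
open import Data.Nat.Induction using (<-wellFounded)
import Data.Nat.Properties as ℕₚ
open import Data.Product.Base using (Σ-syntax; ∃-syntax; _×_; _,_; proj₁; proj₂; map₂)
open import Data.Rational.Base as ℚ using (ℚ; 0ℚ; 1ℚ)
import Data.Rational.Properties as ℚₚ
import Data.Rational.Unnormalised.Base as ℚᵘ
import Data.Rational.Unnormalised.Properties as ℚᵘₚ
open import Data.Sum.Base as Sum using (_⊎_; inj₁; inj₂)
open import Data.Vec.Base as Vec
  using (Vec; []; _∷_; _∷ʳ_; here; there; lookup; updateAt; _[_]≔_; sum; init; last; count; toList)
open import Data.Vec.Properties
  using (lookup-map; lookup∘tabulate; lookup∘updateAt; lookup∘updateAt′; count≤n)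
open import Induction.WellFounded using (Acc; acc)
open import Relation.Binary.Construct.Closure.ReflexiveTransitive using (ε; _◅_)
open import Relation.Binary.PropositionalEquality
open import Relation.Nullary using (¬_; Dec; does; yes; no; contradiction)
open import Relation.Nullary.Decidable using (_⊎-dec_; dec-true; dec-false)
open import Relation.Unary using (_≐_)

private
  variable
    m n r : ℕ
    X : Set

-- Rational sums and uniform averages over the vertices.

ℕ→ℚ : ℕ → ℚ
ℕ→ℚ k = ℤ.+ k ℚ./ 1

ℕ→ℚ-suc : ∀ k → ℕ→ℚ (suc k) ≡ 1ℚ ℚ.+ ℕ→ℚ k
ℕ→ℚ-suc k = ℚₚ.toℚᵘ-injective (begin
  ℚ.toℚᵘ (ℕ→ℚ (suc k))
    ≈⟨ ℚₚ.toℚᵘ-fromℚᵘ (ℚᵘ.mkℚᵘ (ℤ.+ suc k) 0) ⟩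
  ℚᵘ.mkℚᵘ (ℤ.+ suc k) 0
    ≈⟨ ℚᵘ.*≡* (cong (λ z → (1ℤ ℤ.+ z) ℤ.* 1ℤ) (sym (ℤₚ.*-identityʳ (ℤ.+ k)))) ⟩
  ℚᵘ.1ℚᵘ ℚᵘ.+ ℚᵘ.mkℚᵘ (ℤ.+ k) 0
    ≈⟨ ℚᵘₚ.+-congʳ ℚᵘ.1ℚᵘ (ℚₚ.toℚᵘ-fromℚᵘ (ℚᵘ.mkℚᵘ (ℤ.+ k) 0)) ⟨
  ℚ.toℚᵘ 1ℚ ℚᵘ.+ ℚ.toℚᵘ (ℕ→ℚ k)
    ≈⟨ ℚₚ.toℚᵘ-homo-+ 1ℚ (ℕ→ℚ k) ⟨
  ℚ.toℚᵘ (1ℚ ℚ.+ ℕ→ℚ k) ∎)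
  where open ℚᵘₚ.≃-Reasoning

ℕ→ℚ-inverse : ∀ k → ℕ→ℚ (suc k) ℚ.* (1ℤ ℚ./ suc k) ≡ 1ℚ
ℕ→ℚ-inverse k = ℚₚ.toℚᵘ-injective (begin
  ℚ.toℚᵘ (ℕ→ℚ (suc k) ℚ.* (1ℤ ℚ./ suc k))
    ≈⟨ ℚₚ.toℚᵘ-homo-* (ℕ→ℚ (suc k)) _ ⟩
  ℚ.toℚᵘ (ℕ→ℚ (suc k)) ℚᵘ.* ℚ.toℚᵘ (1ℤ ℚ./ suc k)
    ≈⟨ ℚᵘₚ.*-cong (ℚₚ.toℚᵘ-fromℚᵘ (ℚᵘ.mkℚᵘ (ℤ.+ suc k) 0)) (ℚₚ.toℚᵘ-fromℚᵘ (ℚᵘ.mkℚᵘ 1ℤ k)) ⟩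
  ℚᵘ.mkℚᵘ (ℤ.+ suc k) 0 ℚᵘ.* ℚᵘ.mkℚᵘ 1ℤ k
    ≈⟨ ℚᵘₚ.*-inverseʳ (ℚᵘ.mkℚᵘ (ℤ.+ suc k) 0) ⟩
  ℚᵘ.1ℚᵘ ∎)
  where open ℚᵘₚ.≃-Reasoning

Σℚ : (X → ℚ) → List X → ℚ
Σℚ f xs = List.foldr ℚ._+_ 0ℚ (List.map f xs)

Σℚ-const : ∀ a (xs : List X) → Σℚ (λ _ → a) xs ≡ ℕ→ℚ (List.length xs) ℚ.* a
Σℚ-const a []       = sym (ℚₚ.*-zeroˡ a)
Σℚ-const a (x ∷ xs) = begin
  a ℚ.+ Σℚ (λ _ → a) xs                     ≡⟨ cong₂ ℚ._+_ (sym (ℚₚ.*-identityˡ a)) (Σℚ-const a xs) ⟩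
  1ℚ ℚ.* a ℚ.+ ℕ→ℚ (List.length xs) ℚ.* a      ≡⟨ ℚₚ.*-distribʳ-+ a 1ℚ (ℕ→ℚ (List.length xs)) ⟨
  (1ℚ ℚ.+ ℕ→ℚ (List.length xs)) ℚ.* a          ≡⟨ cong (ℚ._* a) (ℕ→ℚ-suc (List.length xs)) ⟨
  ℕ→ℚ (suc (List.length xs)) ℚ.* a             ∎
  where open ≡-Reasoning

Σℚ-mono : {f g : X → ℚ} → (∀ x → f x ℚ.≤ g x) → ∀ xs → Σℚ f xs ℚ.≤ Σℚ g xs
Σℚ-mono f≤g []       = ℚₚ.≤-refl
Σℚ-mono f≤g (x ∷ xs) = ℚₚ.+-mono-≤ (f≤g x) (Σℚ-mono f≤g xs)

Σℚ-deficit : {f g : X → ℚ} {δ : ℚ} → (∀ x → f x ℚ.≤ g x) → ∀ {x xs} → x ∈ xs →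
             f x ℚ.≤ g x ℚ.- δ → Σℚ f xs ℚ.≤ Σℚ g xs ℚ.- δ
Σℚ-deficit {f = f} {g} {δ} f≤g {x} {xs = _ ∷ xs} (here refl) fx≤ = begin
  f x ℚ.+ Σℚ f xs             ≤⟨ ℚₚ.+-mono-≤ fx≤ (Σℚ-mono f≤g xs) ⟩
  g x ℚ.- δ ℚ.+ Σℚ g xs       ≡⟨ ℚₚ.+-assoc (g x) (ℚ.- δ) (Σℚ g xs) ⟩
  g x ℚ.+ (ℚ.- δ ℚ.+ Σℚ g xs) ≡⟨ cong (g x ℚ.+_) (ℚₚ.+-comm (ℚ.- δ) (Σℚ g xs)) ⟩
  g x ℚ.+ (Σℚ g xs ℚ.- δ)     ≡⟨ ℚₚ.+-assoc (g x) (Σℚ g xs) (ℚ.- δ) ⟨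
  g x ℚ.+ Σℚ g xs ℚ.- δ       ∎
  where open ℚₚ.≤-Reasoning
Σℚ-deficit {f = f} {g} {δ} f≤g {xs = y ∷ xs} (there x∈xs) fx≤ = begin
  f y ℚ.+ Σℚ f xs             ≤⟨ ℚₚ.+-mono-≤ (f≤g y) (Σℚ-deficit f≤g x∈xs fx≤) ⟩
  g y ℚ.+ (Σℚ g xs ℚ.- δ)     ≡⟨ ℚₚ.+-assoc (g y) (Σℚ g xs) (ℚ.- δ) ⟨
  g y ℚ.+ Σℚ g xs ℚ.- δ       ∎
  where open ℚₚ.≤-Reasoning

length-vertices : ∀ m n → List.length (vertices m n) ≡ n + m
length-vertices m n = begin
  List.length (vertices m n)
    ≡⟨ length-++ (List.map inj₁ (List.allFin m)) ⟩
  List.length (List.map inj₁ (List.allFin m)) + List.length (List.map inj₂ (List.allFin n))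
    ≡⟨ cong₂ _+_ (trans (length-map inj₁ (List.allFin m)) (length-tabulate {n = m} _))
                   (trans (length-map inj₂ (List.allFin n)) (length-tabulate {n = n} _)) ⟩
  m + n
    ≡⟨ ℕₚ.+-comm m n ⟩
  n + m ∎
  where open ≡-Reasoning

∈-vertices : (v : Vertex m n) → v ∈ vertices m n
∈-vertices (inj₁ i) = ∈-++⁺ˡ (∈-map⁺ inj₁ (∈-allFin i))
∈-vertices {m} (inj₂ j) = ∈-++⁺ʳ (List.map inj₁ (List.allFin m)) (∈-map⁺ inj₂ (∈-allFin j))

weight : ℕ → ℕ → ℚ
weight m n = 1ℤ ℚ./ (suc n + m)

weight-pos : ∀ m n → ℚ.Positive (weight m n)
weight-pos m n = ℚₚ.normalize-pos 1 (suc n + m)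

weight-nonNeg : ∀ m n → ℚ.NonNegative (weight m n)
weight-nonNeg m n = ℚₚ.pos⇒nonNeg (weight m n) {{weight-pos m n}}

average-const : ∀ a → average {m} {n} (λ _ → a) ≡ a
average-const {m} {n} a = begin
  Σℚ (λ _ → a) (vertices m (suc n)) ℚ.* weight m n
    ≡⟨ cong (ℚ._* weight m n) (Σℚ-const a (vertices m (suc n))) ⟩
  ℕ→ℚ (List.length (vertices m (suc n))) ℚ.* a ℚ.* weight m n
    ≡⟨ cong (λ l → ℕ→ℚ l ℚ.* a ℚ.* weight m n) (length-vertices m (suc n)) ⟩
  ℕ→ℚ (suc (n + m)) ℚ.* a ℚ.* weight m n
    ≡⟨ cong (ℚ._* weight m n) (ℚₚ.*-comm (ℕ→ℚ (suc (n + m))) a) ⟩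
  a ℚ.* ℕ→ℚ (suc (n + m)) ℚ.* weight m n
    ≡⟨ ℚₚ.*-assoc a (ℕ→ℚ (suc (n + m))) (weight m n) ⟩
  a ℚ.* (ℕ→ℚ (suc (n + m)) ℚ.* weight m n)
    ≡⟨ cong (a ℚ.*_) (ℕ→ℚ-inverse (n + m)) ⟩
  a ℚ.* 1ℚ
    ≡⟨ ℚₚ.*-identityʳ a ⟩
  a ∎
  where open ≡-Reasoning

average-mono : {f g : Vertex m (suc n) → ℚ} → (∀ v → f v ℚ.≤ g v) →
               average f ℚ.≤ average g
average-mono {m} {n} f≤g =
  ℚₚ.*-monoʳ-≤-nonNeg (weight m n) {{weight-nonNeg m n}} (Σℚ-mono f≤g (vertices m (suc n)))

average-≤ : {f : Vertex m (suc n) → ℚ} {a : ℚ} → (∀ v → f v ℚ.≤ a) → average f ℚ.≤ a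
average-≤ {m} {n} {a = a} f≤a =
  ℚₚ.≤-trans (average-mono f≤a) (ℚₚ.≤-reflexive (average-const {m} {n} a))

-- Each vertex carries weight `weight m n`, so a shortfall of `δ` at a single vertex survives
-- averaging, scaled by that weight. This is how a loss of probability travels backwards along one
-- step of the chain.
average-deficit : {f : Vertex m (suc n) → ℚ} {a : ℚ} (δ : ℚ) → (∀ v → f v ℚ.≤ a) →
                  ∀ v → f v ℚ.≤ a ℚ.- δ → average f ℚ.≤ a ℚ.- δ ℚ.* weight m n
average-deficit {m} {n} {f} {a} δ f≤a v fv≤ = begin
  Σℚ f vs ℚ.* w
    ≤⟨ ℚₚ.*-monoʳ-≤-nonNeg w {{weight-nonNeg m n}} (Σℚ-deficit f≤a (∈-vertices v) fv≤) ⟩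
  (Σℚ (λ _ → a) vs ℚ.- δ) ℚ.* w
    ≡⟨ ℚₚ.*-distribʳ-+ w (Σℚ (λ _ → a) vs) (ℚ.- δ) ⟩
  average {m} {n} (λ _ → a) ℚ.+ ℚ.- δ ℚ.* w
    ≡⟨ cong₂ ℚ._+_ (average-const {m} {n} a) (sym (ℚₚ.neg-distribˡ-* δ w)) ⟩
  a ℚ.- δ ℚ.* w ∎
  where
  open ℚₚ.≤-Reasoning
  vs = vertices m (suc n)
  w  = weight m n

if-≤ : {P : Set} (P? : Dec P) {x y a : ℚ} → (P → x ℚ.≤ a) → (¬ P → y ℚ.≤ a) →
       (if does P? then x else y) ℚ.≤ a
if-≤ (yes p) x≤a _   = x≤a p
if-≤ (no ¬p) _   y≤a = y≤a ¬p

-- Hitting probabilities and escape from a state.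

hitProb≤1 : ∀ k (d c : Config m (suc n)) → hitProb k d c ℚ.≤ 1ℚ
hitProb≤1 zero    d c = ℚₚ.nonNegative⁻¹ 1ℚ
hitProb≤1 (suc k) d c = average-≤ λ v →
  if-≤ (next v c ≟ d) (λ _ → ℚₚ.≤-refl) (λ _ → hitProb≤1 k d (next v c))

-- As `δ` is chosen before `k`, the supremum of the hitting probabilities is bounded away from 1:
-- started at `e`, the chain misses `d` forever with positive probability.
Escapes : Config m (suc n) → Config m (suc n) → Set
Escapes d e = ∃[ δ ] 0ℚ ℚ.< δ × ∀ k → hitProb k d e ℚ.≤ 1ℚ ℚ.- δ

recurrent⇒¬escapes : {c : Config m (suc n)} → RecurrentState c → ¬ Escapes c c
recurrent⇒¬escapes recurrent (δ , 0<δ , bounded) =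
  let k , 1-δ<hit = recurrent δ 0<δ
  in ℚₚ.<-irrefl refl (ℚₚ.<-≤-trans 1-δ<hit (bounded k))

-- The move along `v` has probability `weight m n` and is not itself a visit to `d`, so an escape
-- after the move yields an escape before it.
escapes-step : {d e : Config m (suc n)} (v : Vertex m (suc n)) →
               next v e ≢ d → Escapes d (next v e) → Escapes d e
escapes-step {m} {n} {d} {e} v next≢d (δ , 0<δ , bounded) =
  δ ℚ.* weight m n , 0<δw , λ where
    -- At time 0 the hitting probability is the constant 0, not an average; writing it as an average
    -- of zeros gives the same bound as for later times.
    zero    → ℚₚ.≤-trans (ℚₚ.≤-reflexive (sym (average-const {m} {n} 0ℚ)))
                (average-deficit δ (λ _ → ℚₚ.nonNegative⁻¹ 1ℚ) v (bounded zero))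
    (suc k) → average-deficit δ
                (λ u → if-≤ (next u e ≟ d) (λ _ → ℚₚ.≤-refl) (λ _ → hitProb≤1 k d (next u e)))
                v
                (if-≤ (next v e ≟ d) (λ next≡d → contradiction next≡d next≢d) (λ _ → bounded k))
  where
  0<δw : 0ℚ ℚ.< δ ℚ.* weight m n
  0<δw = ℚₚ.≤-<-trans (ℚₚ.≤-reflexive (sym (ℚₚ.*-zeroˡ (weight m n))))
           (ℚₚ.*-monoˡ-<-pos (weight m n) {{weight-pos m n}} 0<δ)

-- A closed class that the chain cannot leave and whose moves never land on `d` makes every hitting
-- probability 0, so `δ` can be 1.
escapes-closed : {d : Config m (suc n)} (P : Config m (suc n) → Set) →
                 (∀ {e} → P e → ∀ v → next v e ≢ d × P (next v e)) →
                 ∀ {e} → P e → Escapes d e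
escapes-closed {d = d} P closed Pe =
  1ℚ , ℚₚ.positive⁻¹ 1ℚ , λ k → never k Pe
  where
  never : ∀ k {e} → P e → hitProb k d e ℚ.≤ 0ℚ
  never zero        _  = ℚₚ.≤-refl
  never (suc k) {e} Pe = average-≤ λ v →
    let next≢d , Pnext = closed Pe v in
    if-≤ (next v e ≟ d) (λ next≡d → contradiction next≡d next≢d) (λ _ → never k Pnext)

-- Configurations without forbidden subconfigurations.

_without_ : Subset r → Fin r → Subset r
P without i = P [ i ]≔ outside

∈-without : (P : Subset r) {i k : Fin r} → k ∈ˢ P without i → k ∈ˢ P × k ≢ i
∈-without (_ ∷ P) {zero}  (there k∈) = there k∈ , λ ()
∈-without (_ ∷ P) {suc i} here       = here , λ ()
∈-without (_ ∷ P) {suc i} (there k∈) =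
  let k∈P , k≢i = ∈-without P k∈ in there k∈P , λ { refl → k≢i refl }

∣without∣ : (P : Subset r) (i : Fin r) → ∣ P ∣ ≤ suc ∣ P without i ∣
∣without∣ (outside ∷ P) zero    = ℕₚ.n≤1+n _
∣without∣ (inside  ∷ P) zero    = ℕₚ.≤-refl
∣without∣ (outside ∷ P) (suc i) = ∣without∣ P i
∣without∣ (inside  ∷ P) (suc i) = s≤s (∣without∣ P i)

empty⇒∣p∣≤ : {p : Subset r} {k : ℕ} → ¬ Nonempty p → ∣ p ∣ ≤ k
empty⇒∣p∣≤ {r} ¬ne rewrite Empty-unique ¬ne | ∣⊥∣≡0 r = z≤n

-- Inside every nonempty set P ⊎ Q of vertices, some vertex has at least as many
-- grains as it has neighbours in that set (there is no forbidden subconfiguration).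
NoForbidden : Config m n → Set
NoForbidden {m} {n} (t ⨾ b) = (P : Subset m) (Q : Subset n) → Nonempty P ⊎ Nonempty Q →
  (∃[ i ] i ∈ˢ P × ∣ Q ∣ ≤ lookup t i) ⊎ (∃[ j ] j ∈ˢ Q × ∣ P ∣ ≤ lookup b j)

lookup-updateAt-suc : (xs : Vec ℕ r) (i j : Fin r) → lookup xs j ≤ lookup (updateAt xs i suc) j
lookup-updateAt-suc (x ∷ xs) zero    zero    = ℕₚ.n≤1+n x
lookup-updateAt-suc (x ∷ xs) zero    (suc j) = ℕₚ.≤-refl
lookup-updateAt-suc (x ∷ xs) (suc i) zero    = ℕₚ.≤-refl
lookup-updateAt-suc (x ∷ xs) (suc i) (suc j) = lookup-updateAt-suc xs i j

noForbidden-addGrain : (v : Vertex m n) (c : Config m n) → NoForbidden c → NoForbidden (addGrain v c)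
noForbidden-addGrain (inj₁ i) (t ⨾ b) nf P Q ne =
  Sum.map₁ (map₂ λ {k} → map₂ λ q≤ → ℕₚ.≤-trans q≤ (lookup-updateAt-suc t i k)) (nf P Q ne)
noForbidden-addGrain (inj₂ j) (t ⨾ b) nf P Q ne =
  Sum.map₂ (map₂ λ {k} → map₂ λ p≤ → ℕₚ.≤-trans p≤ (lookup-updateAt-suc b j k)) (nf P Q ne)

-- If the toppled vertex v lies in the set, the vertex found in the set without v
-- gains a grain for each edge to v.
noForbidden-topple : (v : Vertex m n) (c : Config m n) → NoForbidden c → NoForbidden (topple v c)
noForbidden-topple {m} {n} (inj₁ i) (t ⨾ b) nf P Q ne with i ∈? P
-- A toppling outside the set takes no grain from any vertex of the set.
... | no i∉P = Sum.map
        (λ (k , k∈P , q≤) → k , k∈P , subst (∣ Q ∣ ≤_)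
           (sym (lookup∘updateAt′ k i (λ { refl → i∉P k∈P }) t)) q≤)
        (λ (k , k∈Q , p≤) → k , k∈Q , ℕₚ.≤-trans p≤
           (ℕₚ.≤-trans (ℕₚ.n≤1+n _) (ℕₚ.≤-reflexive (sym (lookup-map k suc b)))))
        (nf P Q ne)
... | yes i∈P with nonempty? (P without i) ⊎-dec nonempty? Q
-- The set is the toppled vertex alone, which has no neighbour in it.
...   | no empty = inj₁ (i , i∈P , empty⇒∣p∣≤ (λ ne → empty (inj₂ ne)))
...   | yes ne′ = Sum.map
        (λ (k , k∈ , q≤) → k , proj₁ (∈-without P k∈) , subst (∣ Q ∣ ≤_)
           (sym (lookup∘updateAt′ k i (proj₂ (∈-without P k∈)) t)) q≤)
        (λ (k , k∈Q , p≤) → k , k∈Q , ℕₚ.≤-trans (∣without∣ P i)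
           (ℕₚ.≤-trans (s≤s p≤) (ℕₚ.≤-reflexive (sym (lookup-map k suc b)))))
        (nf (P without i) Q ne′)
noForbidden-topple {m} {n} (inj₂ j) (t ⨾ b) nf P Q ne with j ∈? Q
... | no j∉Q = Sum.map
        (λ (k , k∈P , q≤) → k , k∈P , ℕₚ.≤-trans q≤
           (ℕₚ.≤-trans (ℕₚ.n≤1+n _) (ℕₚ.≤-reflexive (sym (lookup-map k suc t)))))
        (λ (k , k∈Q , p≤) → k , k∈Q , subst (∣ P ∣ ≤_)
           (sym (lookup∘updateAt′ k j (λ { refl → j∉Q k∈Q }) b)) p≤)
        (nf P Q ne)
... | yes j∈Q with nonempty? P ⊎-dec nonempty? (Q without j)
...   | no empty = inj₂ (j , j∈Q , empty⇒∣p∣≤ (λ ne → empty (inj₁ ne)))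
...   | yes ne′ = Sum.map
        (λ (k , k∈P , q≤) → k , k∈P , ℕₚ.≤-trans (∣without∣ Q j)
           (ℕₚ.≤-trans (s≤s q≤) (ℕₚ.≤-reflexive (sym (lookup-map k suc t)))))
        (λ (k , k∈ , p≤) → k , proj₁ (∈-without Q k∈) , subst (∣ P ∣ ≤_)
           (sym (lookup∘updateAt′ k j (proj₂ (∈-without Q k∈)) b)) p≤)
        (nf P (Q without j) ne′)

noForbidden-⟶* : {c d : Config m n} → c ⟶* d → NoForbidden c → NoForbidden d
noForbidden-⟶* ε                      nf = nf
noForbidden-⟶* ((v , _ , refl) ◅ rest) nf = noForbidden-⟶* rest (noForbidden-topple v _ nf)

noForbidden-next : (v : Vertex m (suc n)) (c : Config m (suc n)) →
                   NoForbidden c → NoForbidden (next v c)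
noForbidden-next v c nf =
  noForbidden-⟶* (proj₁ (proj₂ (stabilise (addGrain v c)))) (noForbidden-addGrain v c nf)

-- A full bottom vertex holds at least `m` grains, enough for any `P`. If the set has no bottom
-- vertex, each of its top vertices has 0 neighbours in it.
noForbidden-maximal : (c : Config m (suc n)) → (∀ v → degree v ≤ suc (grains c v)) → NoForbidden c
noForbidden-maximal {n = n} c full P Q ne with nonempty? Q | ne
... | yes (j , j∈Q) | _               = inj₂ (j , j∈Q , ℕₚ.≤-trans (∣p∣≤n P) (ℕₚ.≤-pred (full (inj₂ j))))
... | no ¬ne        | inj₁ (i , i∈P)  = inj₁ (i , i∈P , empty⇒∣p∣≤ ¬ne)
... | no ¬ne        | inj₂ ne         = contradiction ne ¬ne

-- In the set of all non-sink vertices, a top vertex would need as many grains as its degree, which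
-- stability excludes; so the vertex found is a bottom one.
noForbidden⇒bottom≥m : (c : Config m (suc n)) → Stable c → NoForbidden c → ∃[ j ] m ≤ lookup (bot c) j
noForbidden⇒bottom≥m {m} {n} c stable nf with nf ⊤ ⊤ (inj₂ (zero , ∈⊤))
... | inj₁ (i , _ , n≤) = contradiction (subst (_≤ lookup (top c) i) (∣⊤∣≡n (suc n)) n≤)
                                        (ℕₚ.<⇒≱ (stable (inj₁ i)))
... | inj₂ (j , _ , m≤) = j , subst (_≤ lookup (bot c) j) (∣⊤∣≡n m) m≤

-- Filling up to the maximal stable configuration.

stable-⟶* : {c d : Config m n} → Stable c → c ⟶* d → d ≡ c
stable-⟶* stable ε                 = refl
stable-⟶* stable ((v , u , _) ◅ _) = contradiction u (ℕₚ.<⇒≱ (stable v))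

next-stable : (v : Vertex m (suc n)) (c : Config m (suc n)) → Stable (addGrain v c) →
              next v c ≡ addGrain v c
next-stable v c stable = stable-⟶* stable (proj₁ (proj₂ (stabilise (addGrain v c))))

lookup-addGrain : ∀ {k} (xs : Vec ℕ r) i → suc (lookup xs i) < k → (∀ j → lookup xs j < k) →
                  ∀ j → lookup (updateAt xs i suc) j < k
lookup-addGrain xs i xi< xs< j with j Finₚ.≟ i
... | yes refl rewrite lookup∘updateAt j {suc} xs       = xi<
... | no  j≢i  rewrite lookup∘updateAt′ j i {suc} j≢i xs = xs< j

stable-addGrain : (v : Vertex m n) (c : Config m n) → suc (grains c v) < degree v →
                  Stable c → Stable (addGrain v c)
stable-addGrain (inj₁ i) (t ⨾ b) v< stable (inj₁ k) =
  lookup-addGrain t i v< (λ k → stable (inj₁ k)) k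
stable-addGrain (inj₁ i) (t ⨾ b) v< stable (inj₂ k) = stable (inj₂ k)
stable-addGrain (inj₂ j) (t ⨾ b) v< stable (inj₁ k) = stable (inj₁ k)
stable-addGrain (inj₂ j) (t ⨾ b) v< stable (inj₂ k) =
  lookup-addGrain b j v< (λ k → stable (inj₂ k)) k

room : ℕ → Vec ℕ r → ℕ
room k xs = sum (Vec.map (k ∸_) xs)

room-suc : ∀ k (xs : Vec ℕ r) i → lookup xs i < k → room k (updateAt xs i suc) < room k xs
room-suc k (x ∷ xs) zero    x<k = ℕₚ.+-monoˡ-< (room k xs) (ℕₚ.∸-monoʳ-< (ℕₚ.n<1+n x) x<k)
room-suc k (x ∷ xs) (suc i) x<k = ℕₚ.+-monoʳ-< (k ∸ x) (room-suc k xs i x<k)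

-- Measured up to the degree, not up to the largest stable value, so that adding a grain to any
-- stable vertex lowers it strictly.
capacity : Config m n → ℕ
capacity {m} {n} (t ⨾ b) = room n t + room (suc m) b

capacity-addGrain : (v : Vertex m n) (c : Config m n) → grains c v < degree v →
                    capacity (addGrain v c) < capacity c
capacity-addGrain {m} {n} (inj₁ i) (t ⨾ b) v< = ℕₚ.+-monoˡ-< (room (suc m) b) (room-suc n t i v<)
capacity-addGrain {m} {n} (inj₂ j) (t ⨾ b) v< = ℕₚ.+-monoʳ-< (room n t) (room-suc (suc m) b j v<)

maximal? : (c : Config m n) →
           (∃[ v ] suc (grains c v) < degree v) ⊎ (∀ v → degree v ≤ suc (grains c v))
maximal? {m} {n} (t ⨾ b)
  with Finₚ.any? (λ i → suc (lookup t i) ℕₚ.<? n) | Finₚ.any? (λ j → suc (lookup b j) ℕₚ.<? suc m)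
... | yes (i , lt) | _            = inj₁ (inj₁ i , lt)
... | no _         | yes (j , lt) = inj₁ (inj₂ j , lt)
... | no ¬t        | no ¬b        = inj₂ λ where
  (inj₁ i) → ℕₚ.≮⇒≥ λ lt → ¬t (i , lt)
  (inj₂ j) → ℕₚ.≮⇒≥ λ lt → ¬b (j , lt)

-- The hypothesis expresses that `c` has a forbidden subconfiguration. The chain preserves
-- `NoForbidden` and each of its new states is stable, so none of them is `c`.
noForbidden⇒escapes : {c e : Config m (suc n)} → (∀ {d} → Stable d → NoForbidden d → d ≢ c) →
                      NoForbidden e → Escapes c e
noForbidden⇒escapes d≢c = escapes-closed NoForbidden λ {e} nf v →
  d≢c (proj₂ (proj₂ (stabilise (addGrain v e)))) (noForbidden-next v e nf) , noForbidden-next v e nf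

-- From e one can add grains without any toppling until all vertices are full; the
-- capacity decreases on the way, so that c is not met.
escapes : {c : Config m (suc n)} → (∀ {d} → Stable d → NoForbidden d → d ≢ c) →
          (e : Config m (suc n)) → Acc _<_ (capacity e) → Stable e → capacity e ≤ capacity c →
          Escapes c e
escapes {c = c} d≢c e (acc rec) stable e≤c with maximal? e
... | inj₂ full     = noForbidden⇒escapes d≢c (noForbidden-maximal e full)
... | inj₁ (v , lt) = escapes-step v (subst (_≢ c) (sym next≡) add≢c)
        (subst (Escapes c) (sym next≡)
          (escapes d≢c (addGrain v e) (rec smaller) stable′ (ℕₚ.≤-trans (ℕₚ.<⇒≤ smaller) e≤c)))
  where
  stable′ = stable-addGrain v e lt stable
  next≡   = next-stable v e stable′
  smaller = capacity-addGrain v e (stable v)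
  add≢c : addGrain v e ≢ c
  add≢c refl = ℕₚ.<⇒≱ smaller e≤c

-- By contradiction, as the search for `j` is decidable: if it fails, no stable configuration
-- satisfying `NoForbidden` equals `c`, and the chain started at `c` escapes from `c`.
recurrent⇒bottom≥m : (c : Config m (suc n)) → DeterministicallyRecurrent c →
                     ∃[ j ] m ≤ lookup (bot c) j
recurrent⇒bottom≥m {m} c (stable , recurrent) with Finₚ.any? (λ j → m ℕₚ.≤? lookup (bot c) j)
... | yes found = found
... | no ¬found = contradiction
        (escapes (λ { sd nf refl → ¬found (noForbidden⇒bottom≥m _ sd nf) })
                 c (<-wellFounded (capacity c)) stable ℕₚ.≤-refl)
        (recurrent⇒¬escapes recurrent)

-- Rows of Ferrers diagrams and sorted sequences.

lookup-∷ʳ-inject₁ : (xs : Vec ℕ r) (x : ℕ) (i : Fin r) → lookup (xs ∷ʳ x) (inject₁ i) ≡ lookup xs i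
lookup-∷ʳ-inject₁ (_ ∷ _)  x zero    = refl
lookup-∷ʳ-inject₁ (_ ∷ xs) x (suc i) = lookup-∷ʳ-inject₁ xs x i

lookup-∷ʳ-fromℕ : (xs : Vec ℕ r) (x : ℕ) → lookup (xs ∷ʳ x) (fromℕ r) ≡ x
lookup-∷ʳ-fromℕ []       x = refl
lookup-∷ʳ-fromℕ (_ ∷ xs) x = lookup-∷ʳ-fromℕ xs x

last≡lookup : (xs : Vec ℕ (suc r)) → last xs ≡ lookup xs (fromℕ r)
last≡lookup (x ∷ [])     = refl
last≡lookup (_ ∷ y ∷ xs) = last≡lookup (y ∷ xs)

lookup-init : (xs : Vec ℕ (suc r)) (i : Fin r) → lookup (init xs) i ≡ lookup xs (inject₁ i)
lookup-init (x ∷ _ ∷ _)  zero    = refl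
lookup-init (_ ∷ y ∷ xs) (suc i) = lookup-init (y ∷ xs) i

F-∷ʳ⁻ : (s : Vec ℕ r) {l x y : ℕ} → F (s ∷ʳ l) (x , y) → F s (x , y) ⊎ (y ≡ r × x < l)
F-∷ʳ⁻ {r} s {l} {x} (i , refl , x<) with view i
... | ‵fromℕ     = inj₂ (Finₚ.toℕ-fromℕ r , subst (x <_) (lookup-∷ʳ-fromℕ s l) x<)
... | ‵inject₁ j = inj₁ (j , sym (Finₚ.toℕ-inject₁ j) , subst (x <_) (lookup-∷ʳ-inject₁ s l j) x<)

F-∷ʳ⁺ˡ : (s : Vec ℕ r) {l x y : ℕ} → F s (x , y) → F (s ∷ʳ l) (x , y)
F-∷ʳ⁺ˡ s {l} {x} (i , refl , x<) =
  inject₁ i , Finₚ.toℕ-inject₁ i , subst (x <_) (sym (lookup-∷ʳ-inject₁ s l i)) x<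

F-∷ʳ⁺ʳ : (s : Vec ℕ r) {l x : ℕ} → x < l → F (s ∷ʳ l) (x , r)
F-∷ʳ⁺ʳ {r} s {l} {x} x< = fromℕ r , Finₚ.toℕ-fromℕ r , subst (x <_) (sym (lookup-∷ʳ-fromℕ s l)) x<

F-map-suc⁺ : (s : Vec ℕ r) (i : Fin r) {x : ℕ} → x ≤ lookup s i → F (Vec.map suc s) (x , toℕ i)
F-map-suc⁺ s i {x} x≤ = i , refl , subst (x <_) (sym (lookup-map i suc s)) (s≤s x≤)

F-map-suc⁻ : (s : Vec ℕ r) {x y : ℕ} → F (Vec.map suc s) (x , y) → ∃[ i ] toℕ i ≡ y × x ≤ lookup s i
F-map-suc⁻ s {x} (i , eq , x<) = i , eq , ℕₚ.≤-pred (subst (x <_) (lookup-map i suc s) x<)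

increasing-tail : {x : ℕ} {s : Vec ℕ r} → Increasing (x ∷ s) → Increasing s
increasing-tail inc i≤j = inc (s≤s i≤j)

increasing-map-suc : (s : Vec ℕ r) → Increasing s → Increasing (Vec.map suc s)
increasing-map-suc s inc {i} {j} i≤j =
  subst₂ _≤_ (sym (lookup-map i suc s)) (sym (lookup-map j suc s)) (s≤s (inc i≤j))

increasing-∷ʳ : (s : Vec ℕ r) {l : ℕ} → Increasing s → (∀ i → lookup s i ≤ l) → Increasing (s ∷ʳ l)
increasing-∷ʳ s {l} inc s≤l {i} {j} i≤j with view i | view j
... | ‵inject₁ i | ‵inject₁ j
      rewrite lookup-∷ʳ-inject₁ s l i | lookup-∷ʳ-inject₁ s l j
            | Finₚ.toℕ-inject₁ i | Finₚ.toℕ-inject₁ j = inc i≤j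
... | ‵inject₁ i | ‵fromℕ
      rewrite lookup-∷ʳ-inject₁ s l i | lookup-∷ʳ-fromℕ s l = s≤l i
... | ‵fromℕ     | ‵fromℕ     = ℕₚ.≤-refl
... | ‵fromℕ {r} | ‵inject₁ j
      rewrite Finₚ.toℕ-fromℕ r | Finₚ.toℕ-inject₁ j = contradiction i≤j (ℕₚ.<⇒≱ (Finₚ.toℕ<n j))

-- Counting small entries of a sorted sequence.

count-< : ∀ {a y} (s : Vec ℕ r) → a < y → count (ℕₚ._<? y) (a ∷ s) ≡ suc (count (ℕₚ._<? y) s)
count-< {a = a} {y} s a<y rewrite dec-true (a ℕₚ.<? y) a<y = refl

count-≮ : ∀ {a y} (s : Vec ℕ r) → ¬ a < y → count (ℕₚ._<? y) (a ∷ s) ≡ count (ℕₚ._<? y) s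
count-≮ {a = a} {y} s a≮y rewrite dec-false (a ℕₚ.<? y) a≮y = refl

-- In a sorted sequence the entries below `y` form an initial segment, so their number is the index
-- where the segment stops. With `⇒<count` this turns row lengths of `kVec` into inequalities on
-- single entries.
<count⇒ : (s : Vec ℕ r) → Increasing s → ∀ {x y} → x < count (ℕₚ._<? y) s →
          ∃[ i ] toℕ i ≡ x × lookup s i < y
<count⇒ (a ∷ s) inc {x} {y} x< with a ℕₚ.<? y
<count⇒ (a ∷ s) inc {zero}  x< | yes a<y = zero , refl , a<y
<count⇒ (a ∷ s) inc {suc x} x< | yes a<y =
  let i , eq , s< = <count⇒ s (increasing-tail inc) (ℕₚ.≤-pred (subst (suc x <_) (count-< s a<y) x<))
  in suc i , cong suc eq , s<
-- A head not below `y` leaves no later entry below `y` either.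
<count⇒ (a ∷ s) inc {x}     x< | no a≮y  =
  let i , _ , s< = <count⇒ s (increasing-tail inc) (subst (x <_) (count-≮ s a≮y) x<) in
  contradiction (ℕₚ.≤-<-trans (inc {zero} {suc i} z≤n) s<) a≮y

⇒<count : (s : Vec ℕ r) → Increasing s → ∀ i {y} → lookup s i < y → toℕ i < count (ℕₚ._<? y) s
⇒<count (a ∷ s) inc i {y} s< with ℕₚ.≤-<-trans (inc {zero} {i} z≤n) s<
⇒<count (a ∷ s) inc zero    s< | a<y rewrite count-< s a<y = s≤s z≤n
⇒<count (a ∷ s) inc (suc i) s< | a<y rewrite count-< s a<y = s≤s (⇒<count s (increasing-tail inc) i s<)

count-mono : (s : Vec ℕ r) → Increasing s → ∀ {y z} → y ≤ z →
             count (ℕₚ._<? y) s ≤ count (ℕₚ._<? z) s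
count-mono s inc y≤z = ℕₚ.≮⇒≥ λ lt →
  let i , eq , s< = <count⇒ s inc lt in
  ℕₚ.<-irrefl eq (⇒<count s inc i (ℕₚ.<-≤-trans s< y≤z))

count-all : (s : Vec ℕ r) → Increasing s → ∀ {y} → (∀ i → lookup s i < y) →
            count (ℕₚ._<? y) s ≡ r
count-all s inc s< = ℕₚ.≤-antisym (count≤n (ℕₚ._<? _) s) (ℕₚ.≮⇒≥ λ lt →
  ℕₚ.<-irrefl (Finₚ.toℕ-fromℕ< lt) (⇒<count s inc (fromℕ< lt) (s< _)))

-- Cells below the upper path.

eastSteps-norths : ∀ k {x y} p → eastSteps (x , y) (List.replicate k N ++ p) ≡ eastSteps (x , k + y) p
eastSteps-norths zero    p = refl
eastSteps-norths (suc k) {x} {y} p =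
  trans (eastSteps-norths k p) (cong (λ z → eastSteps (x , z) p) (ℕₚ.+-suc k y))

eastSteps-∅ : ∀ k {x y} {c} → ¬ c ∈ eastSteps (x , y) (List.replicate k N)
eastSteps-∅ (suc k) c∈ = eastSteps-∅ k c∈

module _ {e : ℕ} where
  -- The bound `y ≤ l` makes the truncated `l ∸ y` the true climb from `y` to `l`.
  eastSteps-levels : ∀ {x y l} (ls : List ℕ) → y ≤ l →
    eastSteps (x , y) (pathWith N E y e (l ∷ ls)) ≡ (x , l) ∷ eastSteps (suc x , l) (pathWith N E l e ls)
  eastSteps-levels {x} {y} {l} ls y≤l =
    trans (eastSteps-norths (l ∸ y) _)
          (cong (λ z → eastSteps (x , z) (E ∷ pathWith N E l e ls)) (ℕₚ.m∸n+n≡m y≤l))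

  -- The E-steps trace the graph of `s`, one per column. The starting point is arbitrary because the
  -- induction moves it along the path.
  ∈-levels⁺ : ∀ {x y} (s : Vec ℕ r) → Increasing s → (∀ i → y ≤ lookup s i) → ∀ i →
              (x + toℕ i , lookup s i) ∈ eastSteps (x , y) (pathWith N E y e (toList s))
  ∈-levels⁺ {x = x} (l ∷ s) inc y≤ zero
    rewrite eastSteps-levels {x} (toList s) (y≤ zero) | ℕₚ.+-identityʳ x = here refl
  ∈-levels⁺ {x = x} (l ∷ s) inc y≤ (suc i)
    rewrite eastSteps-levels {x} (toList s) (y≤ zero) | ℕₚ.+-suc x (toℕ i) =
    there (∈-levels⁺ s (increasing-tail inc) (λ i → inc {zero} {suc i} z≤n) i)

  ∈-levels⁻ : ∀ {x y a h} (s : Vec ℕ r) → Increasing s → (∀ i → y ≤ lookup s i) →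
              (a , h) ∈ eastSteps (x , y) (pathWith N E y e (toList s)) →
              ∃[ i ] a ≡ x + toℕ i × h ≡ lookup s i
  ∈-levels⁻ {y = y} [] inc y≤ c∈ = contradiction c∈ (eastSteps-∅ (e ∸ y))
  ∈-levels⁻ {x = x} (l ∷ s) inc y≤ c∈ rewrite eastSteps-levels {x} (toList s) (y≤ zero) with c∈
  ... | here refl = zero , sym (ℕₚ.+-identityʳ x) , refl
  ... | there c∈′ =
    let i , a≡ , h≡ = ∈-levels⁻ s (increasing-tail inc) (λ i → inc {zero} {suc i} z≤n) c∈′
    in suc i , trans a≡ (sym (ℕₚ.+-suc x (toℕ i))) , h≡

  -- Column `x` has its E-step at height `lookup s x`, so the region below the path is the Ferrers
  -- diagram of `s` reflected in the diagonal; hence the swapped coordinates.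
  below⁺ : (s : Vec ℕ r) → Increasing s → ∀ {x y} → F s (y , x) → Below (pathWith N E 0 e (toList s)) (x , y)
  below⁺ s inc (i , refl , y<) = lookup s i , ∈-levels⁺ s inc (λ _ → z≤n) i , y<

  below⁻ : (s : Vec ℕ r) → Increasing s → ∀ {x y} → Below (pathWith N E 0 e (toList s)) (x , y) → F s (y , x)
  below⁻ s inc {x} {y} (h , h∈ , y<h) =
    let i , x≡ , h≡ = ∈-levels⁻ s inc (λ _ → z≤n) h∈ in i , sym x≡ , subst (y <_) h≡ y<h

-- Cells above the lower path.

∈-easts⁻ : ∀ k {x y a h} p → (a , h) ∈ eastSteps (x , y) (List.replicate k E ++ p) →
           (a < k + x × h ≡ y) ⊎ (a , h) ∈ eastSteps (k + x , y) p
∈-easts⁻ zero        p c∈          = inj₂ c∈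
∈-easts⁻ (suc k) {x} p (here refl) = inj₁ (s≤s (ℕₚ.m≤n+m x k) , refl)
∈-easts⁻ (suc k) {x} {y} {a} {h} p (there c∈)  with ∈-easts⁻ k p c∈
... | inj₁ (a< , h≡) = inj₁ (subst (a <_) (ℕₚ.+-suc k x) a< , h≡)
... | inj₂ c∈′       = inj₂ (subst (λ z → (a , h) ∈ eastSteps (z , y) p) (ℕₚ.+-suc k x) c∈′)

∈-easts⁺ˡ : ∀ k {x y a} p → x ≤ a → a < k + x → (a , y) ∈ eastSteps (x , y) (List.replicate k E ++ p)
∈-easts⁺ˡ zero            p x≤a a< = contradiction x≤a (ℕₚ.<⇒≱ a<)
∈-easts⁺ˡ (suc k) {x} {y} {a} p x≤a a< with ℕₚ.m≤n⇒m<n∨m≡n x≤a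
... | inj₂ refl = here refl
... | inj₁ x<a  = there (∈-easts⁺ˡ k p x<a (subst (a <_) (sym (ℕₚ.+-suc k x)) a<))

∈-easts⁺ʳ : ∀ k {x y c} p → c ∈ eastSteps (k + x , y) p → c ∈ eastSteps (x , y) (List.replicate k E ++ p)
∈-easts⁺ʳ zero            p c∈ = c∈
∈-easts⁺ʳ (suc k) {x} {y} {c} p c∈ =
  there (∈-easts⁺ʳ k p (subst (λ z → c ∈ eastSteps (z , y) p) (sym (ℕₚ.+-suc k x)) c∈))

eastSteps-height : ∀ {x y a h} p → (a , h) ∈ eastSteps (x , y) p → y ≤ h
eastSteps-height (N ∷ p) c∈          = ℕₚ.≤-trans (ℕₚ.n≤1+n _) (eastSteps-height p c∈)
eastSteps-height (E ∷ p) (here refl) = ℕₚ.≤-refl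
eastSteps-height (E ∷ p) (there c∈)  = eastSteps-height p c∈

module _ {e : ℕ} where
  -- The N-step of index `i` leaves height `y + toℕ i` at abscissa `lookup s i`. An E-step no higher
  -- than that precedes it, hence starts strictly to its left.
  above-from⁻ : ∀ {x y a h} (s : Vec ℕ r) → Increasing s → (∀ i → x ≤ lookup s i) →
            (a , h) ∈ eastSteps (x , y) (pathWith E N x e (toList s)) →
            ∀ i → h ≤ y + toℕ i → a < lookup s i
  above-from⁻ {x = x} {y} {a} {h} (l ∷ s) inc x≤ c∈ i h≤
    with ∈-easts⁻ (l ∸ x) (N ∷ pathWith E N l e (toList s)) c∈
  ... | inj₁ (a< , _) = ℕₚ.<-≤-trans (subst (a <_) (ℕₚ.m∸n+n≡m (x≤ zero)) a<) (inc {zero} {i} z≤n)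
  ... | inj₂ c∈′ rewrite ℕₚ.m∸n+n≡m (x≤ zero) with i
  -- Past the first N-step every height is at least `suc y`, too high for `i = zero`.
  ...   | zero  = contradiction (subst (h ≤_) (ℕₚ.+-identityʳ y) h≤)
                    (ℕₚ.<⇒≱ (eastSteps-height (pathWith E N l e (toList s)) c∈′))
  ...   | suc i = above-from⁻ s (increasing-tail inc) (λ i → inc {zero} {suc i} z≤n) c∈′ i
                    (subst (h ≤_) (ℕₚ.+-suc y (toℕ i)) h≤)

  -- Column `a` is crossed either in the first run of E-steps, at height `y`, or later; in the
  -- latter case the bound for `i = zero` excludes `y ≡ b`, and one N-step can be spent. Once the
  -- N-steps run out, `a < e` places the column in the final run.
  above-from⁺ : ∀ {x y a b} (s : Vec ℕ r) → Increasing s → (∀ i → x ≤ lookup s i) →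
            x ≤ a → a < e → y ≤ b → (∀ i → y + toℕ i ≡ b → a < lookup s i) →
            ∃[ h ] (a , h) ∈ eastSteps (x , y) (pathWith E N x e (toList s)) × h ≤ b
  above-from⁺ {x = x} {y} {a} [] inc x≤ x≤a a<e y≤b a< = y , mem , y≤b
    where
    mem : (a , y) ∈ eastSteps (x , y) (List.replicate (e ∸ x) E)
    mem = subst (λ p → (a , y) ∈ eastSteps (x , y) p) (++-identityʳ (List.replicate (e ∸ x) E))
            (∈-easts⁺ˡ (e ∸ x) [] x≤a (subst (a <_) (sym (ℕₚ.m∸n+n≡m x≤e)) a<e))
      where x≤e = ℕₚ.<⇒≤ (ℕₚ.≤-<-trans x≤a a<e)
  above-from⁺ {x = x} {y} {a} (l ∷ s) inc x≤ x≤a a<e y≤b a< with a ℕₚ.<? l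
  ... | yes a<l = y , ∈-easts⁺ˡ (l ∸ x) _ x≤a (subst (a <_) (sym (ℕₚ.m∸n+n≡m (x≤ zero))) a<l) , y≤b
  ... | no  a≮l with ℕₚ.m≤n⇒m<n∨m≡n y≤b
  ...   | inj₂ y≡b = contradiction (a< zero (trans (ℕₚ.+-identityʳ y) y≡b)) a≮l
  ...   | inj₁ y<b =
    let h , h∈ , h≤ = above-from⁺ s (increasing-tail inc) (λ i → inc {zero} {suc i} z≤n)
                        (ℕₚ.≮⇒≥ a≮l) a<e y<b (λ i eq → a< (suc i) (trans (ℕₚ.+-suc y (toℕ i)) eq))
    in h , ∈-easts⁺ʳ (l ∸ x) _
             (subst (λ z → (a , h) ∈ eastSteps (z , y) (N ∷ pathWith E N l e (toList s)))
                    (sym (ℕₚ.m∸n+n≡m (x≤ zero))) h∈) , h≤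

  above⁻ : (s : Vec ℕ r) → Increasing s → ∀ {x y} → Above (pathWith E N 0 e (toList s)) (x , y) →
           ∀ i → toℕ i ≡ y → x < lookup s i
  above⁻ s inc (h , h∈ , h≤y) i refl = above-from⁻ s inc (λ _ → z≤n) h∈ i h≤y

  above⁺ : (s : Vec ℕ r) → Increasing s → ∀ {x y} → x < e → (∀ i → toℕ i ≡ y → x < lookup s i) →
           Above (pathWith E N 0 e (toList s)) (x , y)
  above⁺ s inc x<e x< = above-from⁺ s inc (λ _ → z≤n) z≤n x<e z≤n x<

-- Comparison of the two sets of cells.

module _ (c : Config m (suc n)) (sorted : Sorted c) (recurrent : DeterministicallyRecurrent c) where
  private
    t        = top c
    b        = bot c
    k        = kVec c
    t-inc    = proj₁ sorted
    b-inc    = proj₂ sorted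
    t<n : ∀ i → lookup t i < suc n
    t<n i = proj₁ recurrent (inj₁ i)
    b≤m : ∀ j → lookup b j ≤ m
    b≤m j = ℕₚ.≤-pred (proj₁ recurrent (inj₂ j))
    -- The heights of the E-steps of the upper path; the last belongs to column `m`. Stability keeps
    -- the sequence increasing there.
    levels   = Vec.map suc t ∷ʳ suc n
    levels-inc : Increasing levels
    levels-inc = increasing-∷ʳ (Vec.map suc t) (increasing-map-suc t t-inc)
      λ i → subst (_≤ suc n) (sym (lookup-map i suc t)) (t<n i)

  lookup-kVec : ∀ j → lookup k j ≡ count (ℕₚ._<? suc (toℕ j)) t
  lookup-kVec = lookup∘tabulate _

  lookup-init-kVec : ∀ j {y} → toℕ j ≡ y → lookup (init k) j ≡ count (ℕₚ._<? suc y) t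
  lookup-init-kVec j refl = begin
    lookup (init k) j                           ≡⟨ lookup-init k j ⟩
    lookup k (inject₁ j)                        ≡⟨ lookup-kVec (inject₁ j) ⟩
    count (ℕₚ._<? suc (toℕ (inject₁ j))) t      ≡⟨ cong (λ z → count (ℕₚ._<? suc z) t) (Finₚ.toℕ-inject₁ j) ⟩
    count (ℕₚ._<? suc (toℕ j)) t                ∎
    where open ≡-Reasoning

  kVec-increasing : Increasing k
  kVec-increasing {i} {j} i≤j =
    subst₂ _≤_ (sym (lookup-kVec i)) (sym (lookup-kVec j)) (count-mono t t-inc (s≤s i≤j))

  kVec-last : last k ≡ m
  kVec-last = begin
    last k                                      ≡⟨ last≡lookup k ⟩
    lookup k (fromℕ n)                          ≡⟨ lookup-kVec (fromℕ n) ⟩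
    count (ℕₚ._<? suc (toℕ (fromℕ n))) t        ≡⟨ cong (λ z → count (ℕₚ._<? suc z) t) (Finₚ.toℕ-fromℕ n) ⟩
    count (ℕₚ._<? suc n) t                      ≡⟨ count-all t t-inc t<n ⟩
    m                                           ∎
    where open ≡-Reasoning

  -- Stability gives one inequality. For the other, recurrence provides some entry of at least `m`,
  -- and sortedness carries it to the last place.
  bottom-last : last b ≡ m
  bottom-last = trans (last≡lookup b) (ℕₚ.≤-antisym (b≤m (fromℕ n))
    (let j , m≤ = recurrent⇒bottom≥m c recurrent in ℕₚ.≤-trans m≤ (b-inc (Finₚ.≤fromℕ j))))

  diffDomain : DiffDomain m (Ψ c)
  diffDomain = record
    { increasing₁ = kVec-increasing
    ; increasing₂ = b-inc
    ; last₁       = kVec-last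
    ; last₂       = bottom-last
    }

  F₁′ : Vec ℕ (suc (suc n))
  F₁′ = 0 ∷ (init k ∷ʳ suc (last k))

  -- The empty row put below shifts `k` up by one, cancelling the shift in its definition: row `y`
  -- of `F₁′` has as many cells as there are top entries below `y`.
  F₁′⁻ : ∀ {x y} → y < suc n → F F₁′ (x , y) → ∃[ i ] toℕ i ≡ x × lookup t i < y
  F₁′⁻ y<n (zero , _ , ())
  F₁′⁻ {x} y<n (suc i , refl , x<) with F-∷ʳ⁻ (init k) (i , refl , x<)
  ... | inj₂ (i≡n , _)     = contradiction i≡n (ℕₚ.<⇒≢ (ℕₚ.≤-pred y<n))
  ... | inj₁ (j , j≡ , x<) = <count⇒ t t-inc (subst (x <_) (lookup-init-kVec j j≡) x<)

  F₁′⁺ : ∀ i {y} → y < suc n → lookup t i < y → F F₁′ (toℕ i , y)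
  F₁′⁺ i {suc y} y<n t<y =
    let l , l≡ , i< = F-∷ʳ⁺ˡ (init k)
          (j , j≡y , subst (toℕ i <_) (sym (lookup-init-kVec j j≡y)) (⇒<count t t-inc i t<y))
    in suc l , cong suc l≡ , i<
    where
    j   = fromℕ< (ℕₚ.≤-pred y<n)
    j≡y = Finₚ.toℕ-fromℕ< (ℕₚ.≤-pred y<n)

  -- The lengthened top row of `F₁′` has `suc m` cells and so cancels the full row added to the
  -- second diagram.
  F₁′⁺-top : ∀ {x} → x < suc m → F F₁′ (x , suc n)
  F₁′⁺-top {x} x< =
    let l , l≡ , x<′ = F-∷ʳ⁺ʳ (init k) (subst (λ z → x < suc z) (sym kVec-last) x<)
    in suc l , cong suc l≡ , x<′

  Diff≐Φ : Diff (Ψ c) diffDomain ≐ Φ c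
  Diff≐Φ = to , from
    where
    to : ∀ {cell} → Diff (Ψ c) diffDomain cell → Φ c cell
    to {x , y} (inF₂ , notF₁) with F-∷ʳ⁻ (Vec.map suc b) inF₂
    ... | inj₂ (refl , x<) = contradiction (F₁′⁺-top x<) notF₁
    ... | inj₁ inF with F-map-suc⁻ b inF
    ...   | j , refl , x≤b =
      below⁺ levels levels-inc under ,
      above⁺ (Vec.map suc b) (increasing-map-suc b b-inc) (s≤s x≤m) over
      where
      x≤m = ℕₚ.≤-trans x≤b (b≤m j)
      under : F levels (toℕ j , x)
      under with ℕₚ.m≤n⇒m<n∨m≡n x≤m
      -- In column `m` the upper path runs along the top of the box.
      ... | inj₂ refl = F-∷ʳ⁺ʳ (Vec.map suc t) (Finₚ.toℕ<n j)
      -- Any other column belongs to a top vertex; if it had fewer than `y` grains, the cell would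
      -- lie in `F₁′`.
      ... | inj₁ x<m  = F-∷ʳ⁺ˡ (Vec.map suc t)
        (subst (λ z → F (Vec.map suc t) (toℕ j , z)) i≡x
          (F-map-suc⁺ t i (ℕₚ.≮⇒≥ λ t<y →
            notF₁ (subst (λ z → F F₁′ (z , toℕ j)) i≡x (F₁′⁺ i (Finₚ.toℕ<n j) t<y)))))
        where
        i   = fromℕ< x<m
        i≡x = Finₚ.toℕ-fromℕ< x<m
      over : ∀ i → toℕ i ≡ toℕ j → x < lookup (Vec.map suc b) i
      over i i≡j rewrite Finₚ.toℕ-injective i≡j = proj₂ (proj₂ (F-map-suc⁺ b j x≤b))
    from : ∀ {cell} → Φ c cell → Diff (Ψ c) diffDomain cell
    from {x , y} (under , over) =
      F-∷ʳ⁺ˡ (Vec.map suc b) (j , j≡y , above⁻ (Vec.map suc b) (increasing-map-suc b b-inc) over j j≡y) ,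
      notF₁
      where
      column : (∃[ i ] toℕ i ≡ x × y ≤ lookup t i) ⊎ (x ≡ m × y < suc n)
      column = Sum.map₁ (F-map-suc⁻ t) (F-∷ʳ⁻ (Vec.map suc t) (below⁻ levels levels-inc under))
      y<n : y < suc n
      y<n = Sum.[ (λ (i , _ , y≤) → ℕₚ.≤-<-trans y≤ (t<n i)) , proj₂ ] column
      j   = fromℕ< y<n
      j≡y = Finₚ.toℕ-fromℕ< y<n
      notF₁ : ¬ F F₁′ (x , y)
      notF₁ inF₁ with F₁′⁻ y<n inF₁ | column
      -- Below row `suc n`, cells of `F₁′` lie in columns of top vertices, all left of column `m`.
      ... | i , i≡x , t<y | inj₂ (refl , _)     = ℕₚ.<⇒≢ (Finₚ.toℕ<n i) i≡x
      ... | i , i≡x , t<y | inj₁ (i′ , i′≡x , y≤)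
            rewrite Finₚ.toℕ-injective (trans i≡x (sym i′≡x)) = ℕₚ.<⇒≱ t<y y≤

theorem4p9 : ∀ (m n-1 : ℕ) → let n = suc n-1 in
    (c : Config m n) → Sorted c → DeterministicallyRecurrent c →
    Σ[ d ∈ DiffDomain m (Ψ c) ] (Diff (Ψ c) d ≐ Φ c)
theorem4p9 m n-1 c sorted recurrent = diffDomain c sorted recurrent , Diff≐Φ c sorted recurrent
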